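{- Let $n\ge 3$. The number of permutations of size $n$ that are not in $Av_n(213;2)$ is $$|\mathcal{S}_n\setminus Av(213;2)| = 2 (n-2)! \left( \sum_{i=1}^{n-4} \frac{c_i}{(i-1)!} \right) + 2 (n-2)(n-3)\, c_{n-3} + 2 (n-2)\, c_{n-2} - c_n + 2 c_{n-1},$$ where $c_n=\frac{1}{n+1}\binom{2n}{n}$ is the $n$-th Catalan number (and an empty sum is $0$).
   Context: $\mathcal{S}_n$ is the set of permutations $\pi=\pi_1\pi_2\dots\pi_n$ of $\{1,\dots,n\}$ in one-line notation. Write $\sigma\prec\pi$ if $\pi$ contains the pattern $\sigma$ in the classical sense (some subsequence of $\pi$, not necessarily consecutive, is order-isomorphic to $\sigma$), and $\sigma\nprec\pi$ otherwise. For an entry $k$ of $\pi$, let $s_\pi(k)$ be the biggest sub-string (block of consecutive positions) of $\pi$ that contains the entry $k$ and all of whose entries are greater than or equal to $k$. The sub-permutation of $\pi$ generated by $k$, denoted $g_\pi(k)$, is the permutation obtained by rescaling $s_\pi(k)$ (replacing its entries by $1,2,\dots,|s_\pi(k)|$ in an order-preserving way). For a pattern $\sigma$ and an integer $k\ge 1$, $Av(\sigma;k)$ is the set of permutations $\pi$ for which: $\pi$ avoids $\sigma$ if and only if $g_\pi(k)$ avoids $\sigma$. Equivalently, if $\sigma\prec\pi$ then $\sigma\prec g_\pi(k)$. $Av_n(\sigma;k)=Av(\sigma;k)\cap\mathcal{S}_n$. Thus $\pi\notin Av_n(\sigma;k)$ means $\sigma\prec\pi$ and $\sigma\nprec g_\pi(k)$.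 -}

module Defs where

open import Data.Fin.Base using (cast)
open import Data.Integer.Base using (+_)
open import Data.List.Base
  using (List; []; _∷_; length; lookup; map; filter; concatMap; inits; tails; applyUpTo)
open import Data.List.Extrema.Nat using (argmax)
open import Data.List.Membership.DecPropositional using () renaming (_∈?_ to ∈-dec)
open import Data.List.Membership.Propositional using (_∈_)
open import Data.List.Relation.Binary.Permutation.Propositional using (_↭_)
open import Data.List.Relation.Binary.Sublist.Propositional using (_⊆_)
open import Data.List.Relation.Unary.All using (All; all?)
open import Data.List.Relation.Unary.Unique.Propositional using (Unique)
open import Data.Nat.Base as ℕ using (ℕ; zero; suc; _≤_; _<_; _!)
open import Data.Nat.Combinatorics using (_C_)
open import Data.Nat.Properties using (_≟_; _≤?_; _!≢0)
open import Data.Product.Base using (Σ; ∃-syntax; _×_)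
open import Data.Rational.Base using (ℚ; 0ℚ; _/_; _+_; _*_)
open import Function.Bundles using (_⇔_)
open import Relation.Binary.PropositionalEquality.Core using (_≡_)
open import Relation.Nullary.Decidable.Core using (_×-dec_)
open import Relation.Nullary.Negation.Core using (¬_)
open import Relation.Unary using (Pred)

infix 4 _≅_ _≺_

-- Permutations are words in one-line notation, with entries 1, …, n.
Word : Set
Word = List ℕ

S : ℕ → Pred Word _
S n π = π ↭ applyUpTo suc n

_≅_ : Word → Word → Set
σ ≅ τ = Σ (length σ ≡ length τ) λ eq → ∀ i j →
  lookup σ i < lookup σ j ⇔ lookup τ (cast eq i) < lookup τ (cast eq j)

-- _⊆_ is the (not necessarily contiguous) subsequence relation.
_≺_ : Word → Word → Set
σ ≺ π = ∃[ τ ] (τ ⊆ π × σ ≅ τ)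

_avoids_ : Word → Word → Set
π avoids σ = ¬ (σ ≺ π)

substrings : Word → List Word
substrings π = concatMap inits (tails π)

-- When k is not an entry of π this is the empty word.
s : Word → ℕ → Word
s π k = argmax length [] (filter (λ t → ∈-dec _≟_ k t ×-dec all? (k ≤?_) t) (substrings π))

-- Each entry x is replaced by its rank, the number of entries that are at most x.
rescale : Word → Word
rescale w = map (λ x → length (filter (_≤? x) w)) w

g : Word → ℕ → Word
g π k = rescale (s π k)

Av : Word → ℕ → Pred Word _
Av σ k π = (∃[ n ] S n π) × (π avoids σ ⇔ g π k avoids σ)

record HasCardinality {A : Set} (P : Pred A _) (m : ℕ) : Set where
  field
    elements : List A
    unique   : Unique elements
    exact    : ∀ x → x ∈ elements ⇔ P x
    size     : length elements ≡ m

fromℕ : ℕ → ℚ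
fromℕ m = + m / 1

catalan : ℕ → ℚ
catalan n = (+ 1 / suc n) * fromℕ ((2 ℕ.* n) C n)

infixl 7 _/!_

_/!_ : ℚ → ℕ → ℚ
q /! k = q * (+ 1 / (k !)) {{k !≢0}}

sum₁ : ℕ → (ℕ → ℚ) → ℚ
sum₁ zero    f = 0ℚ
sum₁ (suc m) f = sum₁ m f + f (suc m)

infix 6 sum₁
syntax sum₁ m (λ i → e) = ∑[1≤ i ≤ m ] e

{-# OPTIONS --safe #-}

-- Let 2 lie in the factor w of π = z 1 w or π = w 1 z, so that s_π(2) = w.
-- The permutations whose factor w avoids 213 contain all 213-avoiders, of which
-- there are c_n, so the answer is 2 D(n-2) - c_n, where D(t) is the number of
-- such pairs (z , w), of t + 1 letters in all.  The letters of z are arbitrary;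
-- peeling off the first one gives D(t) = c_{t+1} + t D(t-1), hence
-- D(t) = t! Σ_{0 ≤ i ≤ t} c_{i+1} / i!.
--
-- A word with minimum x avoids 213 iff it is u x v with u and v avoiding 213 and
-- every letter of v below every letter of u; so the avoiders on a given alphabet
-- correspond to binary trees.  Splitting the first tree of a forest at its root
-- gives the recurrence of the ballot numbers, which has the closed form
-- C(2n+k, n) - C(2n+k, n-1) for forests of k+1 trees with n nodes.
module Submission where

open import Defs
open import Data.Fin.Base using (zero; suc)
open import Data.Integer.Base as ℤ using (+_)
import Data.Integer.Properties as ℤ
open import Data.List.Base
  using (List; []; _∷_; _++_; length; map; filter; take; drop; inits; tails; applyUpTo)
open import Data.List.Extrema.Nat using (argmax-sel; f[xs]≤f[argmax])
open import Data.List.Membership.DecPropositional using () renaming (_∈?_ to ∈-dec)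
open import Data.List.Membership.Propositional using (_∈_; _∉_; lose; find)
open import Data.List.Membership.Propositional.Properties
open import Data.List.Membership.Propositional.Properties.WithK using (unique∧set⇒bag)
open import Data.List.Properties
  using (length-++; length-map; length-take; length-drop; length-applyUpTo;
         ++-assoc; ++-identityʳ; ∷-injective; take++drop≡id; ≡-dec)
open import Data.List.Relation.Binary.BagAndSetEquality using (∼bag⇒↭)
open import Data.List.Relation.Binary.Equality.Propositional using (≋⇒≡)
open import Data.List.Relation.Binary.Permutation.Propositional
  using (_↭_; ↭-refl; ↭-sym; ↭-trans; ↭-prep; ↭-reflexive; ↭⇒↭ₛ)
open import Data.List.Relation.Binary.Permutation.Propositional.Properties
  using (shift; drop-mid; drop-∷; ↭-length; ∈-resp-↭; All-resp-↭; ++⁺; ++-comm;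
         ↭-empty-inv; ¬x∷xs↭[])
import Data.List.Relation.Binary.Permutation.Setoid.Properties as SetoidPermutation
open import Data.List.Relation.Binary.Sublist.Propositional
  using (_⊆_; []; _∷_; _∷ʳ_; ⊆-refl; ⊆-trans; to∈; from∈)
open import Data.List.Relation.Binary.Sublist.Propositional.Properties as Sublist
  using (Any-resp-⊆)
open import Data.List.Relation.Unary.All as All using (All; []; _∷_; all?)
import Data.List.Relation.Unary.All.Properties as All
open import Data.List.Relation.Unary.AllPairs as AllPairs using (AllPairs; []; _∷_)
import Data.List.Relation.Unary.AllPairs.Properties as AllPairs
open import Data.List.Relation.Unary.Any using (here; there)
open import Data.List.Relation.Unary.Unique.Propositional using (Unique)
import Data.List.Relation.Unary.Unique.Propositional.Properties as Unique
open import Data.Nat.Base as ℕ using (ℕ; zero; suc; _≤_; _<_; s≤s; z≤n; _∸_; _!)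
open import Data.Nat.Combinatorics
  using (_C_; nCk+nC[k+1]≡[n+1]C[k+1]; nCk≡nC[n∸k]; k>n⇒nCk≡0; nC1≡n)
open import Data.Nat.Properties
open import Data.Nat.Tactic.RingSolver using (solve-∀)
open import Data.Product.Base using (∃₂; ∃-syntax; _×_; _,_; proj₁; proj₂)
open import Data.Product.Properties using (,-injectiveʳ)
open import Data.Rational.Base using (ℚ; 1ℚ; _/_; _+_; _*_; _-_; toℚᵘ)
import Data.Rational.Properties as ℚ
open import Data.Rational.Solver using (module +-*-Solver)
open import Data.Rational.Unnormalised.Base as ℚᵘ using (mkℚᵘ; *≡*; _≃_)
import Data.Rational.Unnormalised.Properties as ℚᵘ
open import Data.Sum.Base using (_⊎_; inj₁; inj₂; [_,_]′)
open import Data.Vec.Base as Vec using (Vec; []; _∷_)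
open import Function.Base using (_∘_; id)
open import Function.Bundles using (_⇔_; mk⇔; Equivalence)
open import Level using (0ℓ)
open import Relation.Binary.Definitions using (DecidableEquality)
open import Relation.Binary.PropositionalEquality
  using (_≡_; refl; sym; trans; cong; cong₂; subst; setoid; module ≡-Reasoning)
open import Relation.Nullary using (¬_; yes; no; contradiction; ¬?)
open import Relation.Nullary.Decidable.Core using (_×-dec_)
open import Relation.Unary using (Pred; _∖_; _∪_) renaming (_⊆_ to _⇛_)
open Equivalence using (to; from)

-- Counting

private variable
  A B : Set
  p q : ℕ

map-unique : {f : A → B} {xs : List A} → (∀ {x y} → x ∈ xs → y ∈ xs → f x ≡ f y → x ≡ y) →
             Unique xs → Unique (map f xs)
map-unique inj []         = []
map-unique inj (x∉ ∷ xs!) =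
  All.map⁺ (All.tabulate λ y∈ eq → All.lookup x∉ y∈ (inj (here refl) (there y∈) eq))
  ∷ map-unique (λ x∈ y∈ → inj (there x∈) (there y∈)) xs!

module _ {A : Set} {P Q : Pred A 0ℓ} where

  card-resp : (∀ x → P x ⇔ Q x) → HasCardinality P p → HasCardinality Q p
  card-resp P⇔Q hc = record
    { elements = elements
    ; unique   = unique
    ; exact    = λ x → mk⇔ (to (P⇔Q x) ∘ to (exact x)) (from (exact x) ∘ from (P⇔Q x))
    ; size     = size
    } where open HasCardinality hc

  card-∪ : (∀ {x} → P x → ¬ Q x) → HasCardinality P p → HasCardinality Q q →
           HasCardinality (P ∪ Q) (p ℕ.+ q)
  card-∪ disjoint hp hq = record
    { elements = P.elements ++ Q.elements
    ; unique   = Unique.++⁺ P.unique Q.unique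
                   λ (p , q) → disjoint (to (P.exact _) p) (to (Q.exact _) q)
    ; exact    = λ x → mk⇔
        ([ inj₁ ∘ to (P.exact x) , inj₂ ∘ to (Q.exact x) ]′ ∘ ∈-++⁻ P.elements)
        [ ∈-++⁺ˡ ∘ from (P.exact x) , ∈-++⁺ʳ P.elements ∘ from (Q.exact x) ]′
    ; size     = trans (length-++ P.elements) (cong₂ ℕ._+_ P.size Q.size)
    } where
      module P = HasCardinality hp
      module Q = HasCardinality hq

-- Two duplicate-free lists with the same members are equal as bags, hence permutations of each
-- other, and so equally long.
card-unique : {P : Pred A 0ℓ} → HasCardinality P p → HasCardinality P q → p ≡ q
card-unique h k = trans (sym H.size) (trans (↭-length same) K.size)
  where
  module H = HasCardinality h
  module K = HasCardinality k
  same = ∼bag⇒↭ (unique∧set⇒bag H.unique K.unique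
    (mk⇔ (from (K.exact _) ∘ to (H.exact _)) (from (H.exact _) ∘ to (K.exact _))))

-- Equality on `A` makes membership in the enumeration of `Q` decidable, so the enumeration of `P`
-- can be filtered by it. The size is given by an addition, which keeps truncated subtraction out of
-- the count.
card-∖ : {P Q : Pred A 0ℓ} → DecidableEquality A → Q ⇛ P → HasCardinality P p → HasCardinality Q q →
         ∃[ k ] HasCardinality (P ∖ Q) k × q ℕ.+ k ≡ p
card-∖ {P = P} {Q} _≟_ Q⊆P hp hq =
  length rest , hr , card-unique (card-resp split (card-∪ (λ q (_ , ¬q) → ¬q q) hq hr)) hp
  where
  module P = HasCardinality hp
  module Q = HasCardinality hq
  _∈?_ = ∈-dec _≟_
  rest = filter (λ x → ¬? (x ∈? Q.elements)) P.elements
  hr : HasCardinality (P ∖ Q) (length rest)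
  hr = record
    { elements = rest
    ; unique   = Unique.filter⁺ (λ x → ¬? (x ∈? Q.elements)) P.unique
    ; exact    = λ x → mk⇔
        (λ x∈ → let (p , ¬q) = ∈-filter⁻ (λ x → ¬? (x ∈? Q.elements)) x∈
                in to (P.exact x) p , ¬q ∘ from (Q.exact x))
        (λ (p , ¬q) → ∈-filter⁺ (λ x → ¬? (x ∈? Q.elements)) (from (P.exact x) p) (¬q ∘ to (Q.exact x)))
    ; size     = refl
    }
  split : ∀ x → (Q ∪ (P ∖ Q)) x ⇔ P x
  split x = mk⇔ [ Q⊆P , proj₁ ]′ λ p → case p (x ∈? Q.elements)
    where
    case : P x → _ → (Q ∪ (P ∖ Q)) x
    case p (yes q) = inj₁ (to (Q.exact x) q)
    case p (no ¬q) = inj₂ (p , ¬q ∘ from (Q.exact x))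

card-image : {P : Pred A 0ℓ} (f : A → B) → (∀ {x y} → P x → P y → f x ≡ f y → x ≡ y) →
             HasCardinality P p → HasCardinality (λ y → ∃[ x ] P x × y ≡ f x) p
card-image f inj hp = record
  { elements = map f elements
  ; unique   = map-unique (λ x∈ y∈ → inj (to (exact _) x∈) (to (exact _) y∈)) unique
  ; exact    = λ y → mk⇔
      (λ y∈ → let (x , x∈ , eq) = ∈-map⁻ f y∈ in x , to (exact x) x∈ , eq)
      (λ { (x , p , refl) → ∈-map⁺ f (from (exact x) p) })
  ; size     = trans (length-map f elements) size
  } where open HasCardinality hp

card-bijection : {P : Pred A 0ℓ} {Q : Pred B 0ℓ} (f : A → B) →
                 (∀ {x y} → P x → P y → f x ≡ f y → x ≡ y) →
                 (∀ {x} → P x → Q (f x)) → (∀ {y} → Q y → ∃[ x ] P x × y ≡ f x) →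
                 HasCardinality P p → HasCardinality Q p
card-bijection f inj into onto =
  card-resp (λ y → mk⇔ (λ { (x , p , refl) → into p }) onto) ∘ card-image f inj

card-∅ : {P : Pred A 0ℓ} → (∀ {x} → ¬ P x) → HasCardinality P 0
card-∅ ∅ = record
  { elements = [] ; unique = [] ; exact = λ x → mk⇔ (λ ()) (λ p → contradiction p ∅) ; size = refl }

card-singleton : (a : A) → HasCardinality (_≡ a) 1
card-singleton a = record
  { elements = a ∷ []
  ; unique   = [] ∷ []
  ; exact    = λ x → mk⇔ (λ { (here eq) → eq ; (there ()) }) here
  ; size     = refl
  }

Fibred : List A → (A → Pred B 0ℓ) → Pred (A × B) 0ℓ
Fibred xs R (a , b) = a ∈ xs × R a b

-- The fibres may vary with `a` while their size stays constant. This is the situation when the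
-- first letter of a word is removed: the remaining alphabet depends on the letter, but the number
-- of completions does not.
card-Fibred : {R : A → Pred B 0ℓ} {xs : List A} → Unique xs →
              (∀ {a} → a ∈ xs → HasCardinality (R a) p) →
              HasCardinality (Fibred xs R) (length xs ℕ.* p)
card-Fibred []         fibre = card-∅ λ ()
card-Fibred {R = R} {a ∷ xs} (a∉ ∷ xs!) fibre =
  card-resp
    (λ (_ , _) → mk⇔ [ (λ { (b , r , refl) → here refl , r }) , (λ (x∈ , r) → there x∈ , r) ]′
               λ { (here refl , r) → inj₁ (_ , r , refl) ; (there x∈ , r) → inj₂ (x∈ , r) })
    (card-∪ (λ { {_ , _} (b , r , refl) (a∈ , _) → All.lookup a∉ a∈ refl })
      (card-image (a ,_) (λ _ _ → ,-injectiveʳ) (fibre (here refl)))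
      (card-Fibred xs! (fibre ∘ there)))

-- Binary trees and Catalan numbers

data Tree : Set where
  leaf : Tree
  node : Tree → Tree → Tree

size : Tree → ℕ
size leaf       = 0
size (node l r) = suc (size l ℕ.+ size r)

total : ∀ {k} → Vec Tree k → ℕ
total []       = 0
total (t ∷ ts) = size t ℕ.+ total ts

-- The ballot numbers: forests of `k` ordered binary trees with `n` nodes in all. The first tree is
-- either a leaf, which is dropped, or a node, whose root is deleted so that one tree becomes two.
forestCount : ℕ → ℕ → ℕ
forestCount zero    zero    = 1
forestCount zero    (suc n) = 0
forestCount (suc k) zero    = forestCount k zero
forestCount (suc k) (suc n) = forestCount k (suc n) ℕ.+ forestCount (2 ℕ.+ k) n

join : ∀ {k} → Vec Tree (2 ℕ.+ k) → Vec Tree (suc k)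
join (l ∷ r ∷ ts) = node l r ∷ ts

total-join : ∀ {k} (ts : Vec Tree (2 ℕ.+ k)) → total (join ts) ≡ suc (total ts)
total-join (l ∷ r ∷ ts) = cong suc (+-assoc (size l) (size r) (total ts))

join-injective : ∀ {k} {ts us : Vec Tree (2 ℕ.+ k)} → join ts ≡ join us → ts ≡ us
join-injective {ts = _ ∷ _ ∷ _} {_ ∷ _ ∷ _} refl = refl

card-forests : ∀ k n → HasCardinality (λ (ts : Vec Tree k) → total ts ≡ n) (forestCount k n)
card-forests zero    zero    =
  card-resp (λ { [] → mk⇔ (λ _ → refl) (λ _ → refl) }) (card-singleton [])
card-forests zero    (suc n) = card-∅ λ { {[]} () }
card-forests (suc k) zero    =
  card-bijection (leaf ∷_) (λ { _ _ refl → refl }) id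
    (λ { {leaf ∷ ts} eq → ts , eq , refl }) (card-forests k zero)
card-forests (suc k) (suc n) = card-resp
  (λ ts → mk⇔
    [ (λ { (us , eq , refl) → eq })
    , (λ { (us , eq , refl) → trans (total-join us) (cong suc eq) }) ]′
    λ { eq → decompose ts eq })
  (card-∪ (λ { (_ , _ , refl) (_ ∷ _ ∷ _ , _ , ()) })
    (card-image (leaf ∷_) (λ { _ _ refl → refl }) (card-forests k (suc n)))
    (card-image join (λ _ _ → join-injective) (card-forests (2 ℕ.+ k) n)))
  where
  decompose : ∀ ts → total ts ≡ suc n →
    (∃[ us ] total us ≡ suc n × ts ≡ leaf ∷ us) ⊎ (∃[ us ] total us ≡ n × ts ≡ join us)
  decompose (leaf ∷ ts)     eq = inj₁ (ts , eq , refl)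
  decompose (node l r ∷ ts) eq =
    inj₂ (l ∷ r ∷ ts , suc-injective (trans (sym (total-join (l ∷ r ∷ ts))) eq) , refl)

card-trees : ∀ n → HasCardinality (λ t → size t ≡ n) (forestCount 1 n)
card-trees n = card-bijection Vec.head
  (λ { {_ ∷ []} {_ ∷ []} _ _ refl → refl })
  (λ { {t ∷ []} eq → trans (sym (+-identityʳ (size t))) eq })
  (λ { {t} refl → t ∷ [] , +-identityʳ (size t) , refl })
  (card-forests 1 n)

forests-0 : ∀ k → forestCount k 0 ≡ 1
forests-0 zero    = refl
forests-0 (suc k) = forests-0 k

-- 2* j + k is 2j + k, recursing on j so that the induction steps of `ballot` reduce.
infix 7 2*_+_
2*_+_ : ℕ → ℕ → ℕ
2* zero  + k = k
2* suc j + k = suc (suc (2* j + k))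

2*+-suc : ∀ j k → 2* j + suc k ≡ suc (2* j + k)
2*+-suc zero    k = refl
2*+-suc (suc j) k = cong (2 ℕ.+_) (2*+-suc j k)

2*+≡ : ∀ j k → 2* j + k ≡ 2 ℕ.* j ℕ.+ k
2*+≡ zero    k = refl
2*+≡ (suc j) k = cong suc (trans (cong suc (2*+≡ j k)) (lemma j k))
  where
  lemma : ∀ j k → suc (2 ℕ.* j ℕ.+ k) ≡ j ℕ.+ (suc j ℕ.+ 0) ℕ.+ k
  lemma = solve-∀

-- The two middle entries of row `2j + 1` of Pascal's triangle agree by symmetry.
central : ∀ j → suc (2* j + 0) C j ≡ suc (2* j + 0) C suc j
central j = trans (nCk≡nC[n∸k] (m≤n⇒m≤1+n (≤-trans (m≤m+n j _) (≤-reflexive (sym eq)))))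
  (cong (suc (2* j + 0) C_) (trans (cong (λ m → suc m ℕ.∸ j) eq)
    (trans (cong (ℕ._∸ j) (sym (+-suc j j))) (m+n∸m≡n j (suc j)))))
  where
  eq : 2* j + 0 ≡ j ℕ.+ j
  eq = trans (2*+≡ j 0) (lemma j)
    where
    lemma : ∀ j → 2 ℕ.* j ℕ.+ 0 ≡ j ℕ.+ j
    lemma = solve-∀

pascal : ∀ n k → suc n C suc k ≡ n C k ℕ.+ n C suc k
pascal n k = sym (nCk+nC[k+1]≡[n+1]C[k+1] n k)

-- The ballot formula C(2n+k, n) - C(2n+k, n-1) at n = j + 1, free of subtraction.
Ballot : ℕ → ℕ → Set
Ballot j k = forestCount (suc k) (suc j) ℕ.+ (2* suc j + k) C j ≡ (2* suc j + k) C suc j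

-- An empty forest has no nodes, so a single nonempty tree is counted by its two subtrees alone,
-- which is the case `k = 1`. Pascal's rule on both sides leaves the two middle coefficients of row
-- `2j + 3`, equal by `central`.
ballot-suc-0 : ∀ j → Ballot j 1 → Ballot (suc j) 0
ballot-suc-0 j ih
  rewrite pascal (suc (2* suc j + 0)) j | pascal (suc (2* suc j + 0)) (suc j)
        | sym (central (suc j)) =
  trans (sym (+-assoc (forestCount 2 (suc j)) _ _)) (cong (ℕ._+ suc (2* suc j + 0) C suc j)
    (subst (λ m → forestCount 2 (suc j) ℕ.+ m C j ≡ m C suc j) (2*+-suc (suc j) 0) ih))

ballot-0-suc : ∀ k → Ballot 0 k → Ballot 0 (suc k)
ballot-0-suc k ih rewrite pascal (2* 1 + k) 0 =
  trans (cong (λ m → forestCount (suc k) 1 ℕ.+ m ℕ.+ 1) (forests-0 k))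
    (trans (+-comm _ 1) (cong suc ih))

-- The recursion of `forestCount` matches Pascal's rule: one node less and two trees more give the
-- same row, as `2(j + 1) + (k + 2) = 2(j + 2) + k`, so the claim is the sum of the two hypotheses.
ballot-suc-suc : ∀ j k → Ballot (suc j) k → Ballot j (2 ℕ.+ k) → Ballot (suc j) (suc k)
ballot-suc-suc j k ih₁ ih₂
  rewrite 2*+-suc j k | pascal (2* suc (suc j) + k) j | pascal (2* suc (suc j) + k) (suc j) =
  trans (regroup (forestCount (suc k) (2 ℕ.+ j)) (forestCount (3 ℕ.+ k) (suc j)) _ _)
    (cong₂ ℕ._+_
      (subst (λ m → forestCount (3 ℕ.+ k) (suc j) ℕ.+ m C j ≡ m C suc j)
        (trans (2*+-suc (suc j) (suc k)) (cong suc (2*+-suc (suc j) k))) ih₂)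
      ih₁)
  where
  regroup : ∀ a b c d → (a ℕ.+ b) ℕ.+ (c ℕ.+ d) ≡ (b ℕ.+ c) ℕ.+ (a ℕ.+ d)
  regroup = solve-∀

ballot : ∀ j k → Ballot j k
ballot zero    zero    = refl
ballot zero    (suc k) = ballot-0-suc k (ballot zero k)
ballot (suc j) zero    = ballot-suc-0 j (ballot j 1)
ballot (suc j) (suc k) = ballot-suc-suc j k (ballot (suc j) k) (ballot j (2 ℕ.+ k))

-- (j + 1) C(m, j + 1) = (m - j) C(m, j), with the subtraction moved to the other side.
absorption : ∀ m j → suc j ℕ.* (m C suc j) ℕ.+ j ℕ.* (m C j) ≡ m ℕ.* (m C j)
absorption zero zero    = refl
absorption zero (suc j)
  rewrite k>n⇒nCk≡0 {0} {2 ℕ.+ j} (s≤s z≤n) | k>n⇒nCk≡0 {0} {suc j} (s≤s z≤n) =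
  cong₂ ℕ._+_ (*-zeroʳ (2 ℕ.+ j)) (*-zeroʳ (suc j))
absorption (suc m) zero rewrite nC1≡n (suc m) = lemma m
  where
  lemma : ∀ m → (suc m ℕ.+ 0) ℕ.+ 0 ≡ suc m ℕ.* 1
  lemma = solve-∀
absorption (suc m) (suc j) rewrite pascal m j | pascal m (suc j) =
  trans (regroup j (m C j) (m C suc j) (m C suc (suc j)))
    (trans (cong₂ (λ x y → x ℕ.+ y ℕ.+ m C suc j ℕ.+ m C j) (absorption m (suc j)) (absorption m j))
      (expand m (m C j) (m C suc j)))
  where
  regroup : ∀ j a b c → (2 ℕ.+ j) ℕ.* (b ℕ.+ c) ℕ.+ suc j ℕ.* (a ℕ.+ b) ≡
            ((2 ℕ.+ j) ℕ.* c ℕ.+ suc j ℕ.* b) ℕ.+ (suc j ℕ.* b ℕ.+ j ℕ.* a) ℕ.+ b ℕ.+ a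
  regroup = solve-∀
  expand : ∀ m a b → m ℕ.* b ℕ.+ m ℕ.* a ℕ.+ b ℕ.+ a ≡ suc m ℕ.* (a ℕ.+ b)
  expand = solve-∀

-- By the ballot formula the number of trees is `C(2n, n) - C(2n, n-1)`. Absorption gives
-- `n C(2n, n) = (n+1) C(2n, n-1)`, so multiplying by `n + 1` leaves a single `C(2n, n)`.
[1+n]*trees : ∀ n → suc n ℕ.* forestCount 1 n ≡ (2 ℕ.* n) C n
[1+n]*trees zero    = refl
[1+n]*trees n@(suc j) = +-cancelʳ-≡ (suc n ℕ.* (m C j)) _ _ (begin
  suc n ℕ.* forestCount 1 n ℕ.+ suc n ℕ.* (m C j)
    ≡⟨ *-distribˡ-+ (suc n) (forestCount 1 n) (m C j) ⟨
  suc n ℕ.* (forestCount 1 n ℕ.+ m C j)           ≡⟨ cong (suc n ℕ.*_)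
    (subst (λ m → forestCount 1 n ℕ.+ m C j ≡ m C n) eq (ballot j 0)) ⟩
  m C n ℕ.+ n ℕ.* (m C n)                     ≡⟨ cong (m C n ℕ.+_) absorb ⟩
  m C n ℕ.+ suc n ℕ.* (m C j)                 ∎)
  where
  open ≡-Reasoning
  m = 2 ℕ.* n
  eq : 2* n + 0 ≡ m
  eq = trans (2*+≡ n 0) (+-identityʳ m)
  split : ∀ j c → 2 ℕ.* suc j ℕ.* c ≡ (2 ℕ.+ j) ℕ.* c ℕ.+ j ℕ.* c
  split = solve-∀
  absorb : n ℕ.* (m C n) ≡ suc n ℕ.* (m C j)
  absorb = +-cancelʳ-≡ (j ℕ.* (m C j)) _ _ (trans (absorption m j) (split j (m C j)))

-- The closed formula

-- The fraction `+ m / 1` is normalised by a gcd, which does not reduce for a variable `m`. In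
-- unnormalised form, sums and products can be compared on numerators.
toℚᵘ-fromℕ : ∀ m → toℚᵘ (fromℕ m) ≃ mkℚᵘ (+ m) 0
toℚᵘ-fromℕ m = ℚ.toℚᵘ-fromℚᵘ (mkℚᵘ (+ m) 0)

fromℕ-+ : ∀ m n → fromℕ (m ℕ.+ n) ≡ fromℕ m + fromℕ n
fromℕ-+ m n = ℚ.toℚᵘ-injective (begin
  toℚᵘ (fromℕ (m ℕ.+ n))              ≈⟨ toℚᵘ-fromℕ (m ℕ.+ n) ⟩
  mkℚᵘ (+ (m ℕ.+ n)) 0                ≈⟨ *≡* (cong (ℤ._* + 1) (sym (cong₂ ℤ._+_
                                                (ℤ.*-identityʳ (+ m)) (ℤ.*-identityʳ (+ n))))) ⟩
  mkℚᵘ (+ m) 0 ℚᵘ.+ mkℚᵘ (+ n) 0      ≈⟨ ℚᵘ.+-cong (toℚᵘ-fromℕ m) (toℚᵘ-fromℕ n) ⟨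
  toℚᵘ (fromℕ m) ℚᵘ.+ toℚᵘ (fromℕ n)  ≈⟨ ℚ.toℚᵘ-homo-+ (fromℕ m) (fromℕ n) ⟨
  toℚᵘ (fromℕ m + fromℕ n)            ∎)
  where open ℚᵘ.≃-Reasoning

fromℕ-* : ∀ m n → fromℕ (m ℕ.* n) ≡ fromℕ m * fromℕ n
fromℕ-* m n = ℚ.toℚᵘ-injective (begin
  toℚᵘ (fromℕ (m ℕ.* n))              ≈⟨ toℚᵘ-fromℕ (m ℕ.* n) ⟩
  mkℚᵘ (+ (m ℕ.* n)) 0                ≈⟨ *≡* (cong (ℤ._* + 1) (ℤ.pos-* m n)) ⟩
  mkℚᵘ (+ m) 0 ℚᵘ.* mkℚᵘ (+ n) 0      ≈⟨ ℚᵘ.*-cong (toℚᵘ-fromℕ m) (toℚᵘ-fromℕ n) ⟨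
  toℚᵘ (fromℕ m) ℚᵘ.* toℚᵘ (fromℕ n)  ≈⟨ ℚ.toℚᵘ-homo-* (fromℕ m) (fromℕ n) ⟨
  toℚᵘ (fromℕ m * fromℕ n)            ∎)
  where open ℚᵘ.≃-Reasoning

1/m*m : ∀ m .{{_ : ℕ.NonZero m}} → (+ 1 / m) * fromℕ m ≡ 1ℚ
1/m*m m@(suc k) = ℚ.toℚᵘ-injective (begin
  toℚᵘ ((+ 1 / m) * fromℕ m)              ≈⟨ ℚ.toℚᵘ-homo-* (+ 1 / m) (fromℕ m) ⟩
  toℚᵘ (+ 1 / m) ℚᵘ.* toℚᵘ (fromℕ m)
    ≈⟨ ℚᵘ.*-cong (ℚ.toℚᵘ-fromℚᵘ (mkℚᵘ (+ 1) k)) (toℚᵘ-fromℕ m) ⟩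
  mkℚᵘ (+ 1) k ℚᵘ.* mkℚᵘ (+ m) 0          ≈⟨ *≡* (cong +_ (lemma k)) ⟩
  toℚᵘ 1ℚ                                 ∎)
  where
  open ℚᵘ.≃-Reasoning
  lemma : ∀ k → (suc k ℕ.+ 0) ℕ.* 1 ≡ suc (k ℕ.* 1 ℕ.+ 0)
  lemma = solve-∀

catalan≡ : ∀ n → catalan n ≡ fromℕ (forestCount 1 n)
catalan≡ n = begin
  (+ 1 / suc n) * fromℕ ((2 ℕ.* n) C n)
    ≡⟨ cong (λ m → (+ 1 / suc n) * fromℕ m) (sym ([1+n]*trees n)) ⟩
  (+ 1 / suc n) * fromℕ (suc n ℕ.* forestCount 1 n)
    ≡⟨ cong ((+ 1 / suc n) *_) (fromℕ-* (suc n) (forestCount 1 n)) ⟩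
  (+ 1 / suc n) * (fromℕ (suc n) * fromℕ (forestCount 1 n))
    ≡⟨ ℚ.*-assoc (+ 1 / suc n) (fromℕ (suc n)) (fromℕ (forestCount 1 n)) ⟨
  ((+ 1 / suc n) * fromℕ (suc n)) * fromℕ (forestCount 1 n)
    ≡⟨ cong (_* fromℕ (forestCount 1 n)) (1/m*m (suc n)) ⟩
  1ℚ * fromℕ (forestCount 1 n)                          ≡⟨ ℚ.*-identityˡ _ ⟩
  fromℕ (forestCount 1 n)                               ∎
  where open ≡-Reasoning

-- This is D(t), with `forestCount 1` in the role of the Catalan numbers; at `t = 0` the term
-- `t D(t-1)` is absent.
pairCount : ℕ → ℕ
pairCount zero    = forestCount 1 1
pairCount (suc t) = forestCount 1 (2 ℕ.+ t) ℕ.+ suc t ℕ.* pairCount t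

catalanSum : ℕ → ℚ
catalanSum m = ∑[1≤ i ≤ m ] (catalan i /! (i ∸ 1))

pairs≡ : ∀ t → fromℕ (pairCount t) ≡ fromℕ (t !) * catalanSum (suc t)
pairs≡ zero    = refl
pairs≡ (suc t) = begin
  fromℕ (forestCount 1 (2 ℕ.+ t) ℕ.+ suc t ℕ.* pairCount t)
    ≡⟨ fromℕ-+ (forestCount 1 (2 ℕ.+ t)) (suc t ℕ.* pairCount t) ⟩
  fromℕ (forestCount 1 (2 ℕ.+ t)) + fromℕ (suc t ℕ.* pairCount t)
    ≡⟨ cong₂ _+_ (sym (catalan≡ (2 ℕ.+ t)))
         (trans (fromℕ-* (suc t) (pairCount t)) (cong (fromℕ (suc t) *_) (pairs≡ t))) ⟩
  c + fromℕ (suc t) * (fromℕ (t !) * Σc)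
    -- A factor `(1 / (t+1)!) (t+1)!` is inserted at `c`, so that `(t+1)!` can be taken out and
    -- `c * r` becomes the new last summand.
    ≡⟨ cong (_+ fromℕ (suc t) * (fromℕ (t !) * Σc))
         (trans (sym (ℚ.*-identityˡ c)) (cong (_* c) (sym (1/m*m (suc t !) {{suc t !≢0}})))) ⟩
  (r * fromℕ (suc t !)) * c + fromℕ (suc t) * (fromℕ (t !) * Σc)
    ≡⟨ cong (λ x → (r * x) * c + fromℕ (suc t) * (fromℕ (t !) * Σc)) (fromℕ-* (suc t) (t !)) ⟩
  (r * (fromℕ (suc t) * fromℕ (t !))) * c + fromℕ (suc t) * (fromℕ (t !) * Σc)
    ≡⟨ regroup r (fromℕ (suc t)) (fromℕ (t !)) c Σc ⟩
  (fromℕ (suc t) * fromℕ (t !)) * (Σc + c * r)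
    ≡⟨ cong (_* (Σc + c * r)) (sym (fromℕ-* (suc t) (t !))) ⟩
  fromℕ (suc t !) * (Σc + c * r)                         ∎
  where
  open ≡-Reasoning
  c = catalan (2 ℕ.+ t)
  r = (+ 1 / (suc t !)) {{suc t !≢0}}
  Σc = catalanSum (suc t)
  regroup : ∀ r m f c Σc → (r * (m * f)) * c + m * (f * Σc) ≡ (m * f) * (Σc + c * r)
  regroup = solve 5 (λ r m f c Σc → (r :* (m :* f)) :* c :+ m :* (f :* Σc) :=
                                (m :* f) :* (Σc :+ c :* r)) refl
    where open +-*-Solver

-- Two steps of the recursion of `pairCount`; for u = 0 the factor u kills the junk
-- value of u ∸ 1.
pairs-tail : ∀ u → fromℕ (suc u ℕ.* u ℕ.* pairCount (u ∸ 1)) ≡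
             fromℕ (suc u !) * catalanSum (u ∸ 1) + fromℕ (suc u ℕ.* u) * catalan u
pairs-tail zero          = refl
pairs-tail (suc zero)    = refl
pairs-tail (suc (suc v)) = begin
  fromℕ (a ℕ.* (f ℕ.+ suc v ℕ.* pairCount v))
    ≡⟨ cong fromℕ (expand a f (suc v) (pairCount v)) ⟩
  fromℕ (a ℕ.* suc v ℕ.* pairCount v ℕ.+ a ℕ.* f)
    ≡⟨ fromℕ-+ (a ℕ.* suc v ℕ.* pairCount v) (a ℕ.* f) ⟩
  fromℕ (a ℕ.* suc v ℕ.* pairCount v) + fromℕ (a ℕ.* f)
    ≡⟨ cong₂ _+_ (trans (fromℕ-* (a ℕ.* suc v) (pairCount v))
                        (cong (fromℕ (a ℕ.* suc v) *_) (pairs≡ v)))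
                 (trans (fromℕ-* a f) (cong (fromℕ a *_) (sym (catalan≡ (2 ℕ.+ v))))) ⟩
  fromℕ (a ℕ.* suc v) * (fromℕ (v !) * catalanSum (suc v)) + fromℕ a * catalan (2 ℕ.+ v)
    ≡⟨ cong (_+ fromℕ a * catalan (2 ℕ.+ v))
         (trans (sym (ℚ.*-assoc (fromℕ (a ℕ.* suc v)) (fromℕ (v !)) (catalanSum (suc v))))
           (cong (_* catalanSum (suc v))
             (trans (sym (fromℕ-* (a ℕ.* suc v) (v !)))
               (cong fromℕ (assoc (3 ℕ.+ v) (2 ℕ.+ v) (suc v) (v !)))))) ⟩
  fromℕ ((3 ℕ.+ v) !) * catalanSum (suc v) + fromℕ a * catalan (2 ℕ.+ v) ∎
  where
  open ≡-Reasoning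
  a = (3 ℕ.+ v) ℕ.* (2 ℕ.+ v)
  f = forestCount 1 (2 ℕ.+ v)
  expand : ∀ a f s p → a ℕ.* (f ℕ.+ s ℕ.* p) ≡ a ℕ.* s ℕ.* p ℕ.+ a ℕ.* f
  expand = solve-∀
  assoc : ∀ a b c d → a ℕ.* b ℕ.* c ℕ.* d ≡ a ℕ.* (b ℕ.* (c ℕ.* d))
  assoc = solve-∀

-- Here `n = 3 + u`. Unrolling D(u+1) twice gives `c_{u+2} + (u+1) (c_{u+1} + u D(u-1))`. The last
-- unrolling produces two of the separate Catalan terms, and `pairs-tail` splits the third off
-- D(u-1), leaving a sum that ends at `n - 4`.
formula : ∀ u N → forestCount 1 (3 ℕ.+ u) ℕ.+ N ≡ pairCount (suc u) ℕ.+ pairCount (suc u) →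
  fromℕ N ≡
    fromℕ (2 ℕ.* (suc u) !) * catalanSum (u ∸ 1)
    + fromℕ (2 ℕ.* suc u ℕ.* u) * catalan u
    + fromℕ (2 ℕ.* suc u) * catalan (suc u)
    - catalan (3 ℕ.+ u)
    + fromℕ 2 * catalan (2 ℕ.+ u)
formula u N eq = begin
  fromℕ N                                                   ≡⟨ cancel (fromℕ N) (fromℕ c₃) ⟩
  (fromℕ c₃ + fromℕ N) - fromℕ c₃
    ≡⟨ cong (_- fromℕ c₃) (sym (fromℕ-+ c₃ N)) ⟩
  fromℕ (c₃ ℕ.+ N) - fromℕ c₃
    ≡⟨ cong (λ m → fromℕ m - fromℕ c₃) (trans eq (unfold u)) ⟩
  fromℕ (2 ℕ.* (c₂ ℕ.+ (t ℕ.* c₁ ℕ.+ tail))) - fromℕ c₃     ≡⟨ cong (_- fromℕ c₃) push ⟩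
  fromℕ 2 * (fromℕ c₂ + (fromℕ t * fromℕ c₁ + fromℕ tail)) - fromℕ c₃
    ≡⟨ cong₂ (λ x y → fromℕ 2 * x - y)
         (cong₂ _+_ (sym (catalan≡ (2 ℕ.+ u)))
           (cong₂ _+_ (cong (fromℕ t *_) (sym (catalan≡ (suc u)))) (pairs-tail u)))
         (sym (catalan≡ (3 ℕ.+ u))) ⟩
  fromℕ 2 * (catalan (2 ℕ.+ u) + (fromℕ t * catalan (suc u) +
    (fromℕ (t !) * catalanSum (u ∸ 1) + fromℕ (t ℕ.* u) * catalan u))) - catalan (3 ℕ.+ u)
    ≡⟨ regroup (fromℕ 2) (catalan (2 ℕ.+ u)) (fromℕ t) (catalan (suc u)) (fromℕ (t !))
         (catalanSum (u ∸ 1)) (fromℕ (t ℕ.* u)) (catalan u) (catalan (3 ℕ.+ u)) ⟩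
  (fromℕ 2 * fromℕ (t !)) * catalanSum (u ∸ 1)
    + (fromℕ 2 * fromℕ (t ℕ.* u)) * catalan u
    + (fromℕ 2 * fromℕ t) * catalan (suc u)
    - catalan (3 ℕ.+ u)
    + fromℕ 2 * catalan (2 ℕ.+ u)
    ≡⟨ cong (λ x → x - catalan (3 ℕ.+ u) + fromℕ 2 * catalan (2 ℕ.+ u))
         (cong₂ _+_ (cong₂ _+_
           (cong (_* catalanSum (u ∸ 1)) (sym (fromℕ-* 2 (t !))))
           (cong (_* catalan u) (trans (sym (fromℕ-* 2 (t ℕ.* u)))
             (cong fromℕ (sym (*-assoc 2 t u))))))
           (cong (_* catalan (suc u)) (sym (fromℕ-* 2 t)))) ⟩
  _ ∎
  where
  open ≡-Reasoning
  t = suc u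
  c₁ = forestCount 1 (suc u)
  c₂ = forestCount 1 (2 ℕ.+ u)
  c₃ = forestCount 1 (3 ℕ.+ u)
  tail = t ℕ.* u ℕ.* pairCount (u ∸ 1)
  expand : ∀ c₂ t c₁ u p → (c₂ ℕ.+ t ℕ.* (c₁ ℕ.+ u ℕ.* p)) ℕ.+ (c₂ ℕ.+ t ℕ.* (c₁ ℕ.+ u ℕ.* p)) ≡
           2 ℕ.* (c₂ ℕ.+ (t ℕ.* c₁ ℕ.+ t ℕ.* u ℕ.* p))
  expand = solve-∀
  unfold : ∀ u → pairCount (suc u) ℕ.+ pairCount (suc u) ≡
    2 ℕ.* (forestCount 1 (2 ℕ.+ u) ℕ.+
           (suc u ℕ.* forestCount 1 (suc u) ℕ.+ suc u ℕ.* u ℕ.* pairCount (u ∸ 1)))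
  unfold zero    = refl
  unfold (suc v) =
    expand (forestCount 1 (3 ℕ.+ v)) (2 ℕ.+ v) (forestCount 1 (2 ℕ.+ v)) (suc v) (pairCount v)
  push : fromℕ (2 ℕ.* (c₂ ℕ.+ (t ℕ.* c₁ ℕ.+ tail))) ≡
         fromℕ 2 * (fromℕ c₂ + (fromℕ t * fromℕ c₁ + fromℕ tail))
  push = trans (fromℕ-* 2 (c₂ ℕ.+ (t ℕ.* c₁ ℕ.+ tail))) (cong (fromℕ 2 *_)
    (trans (fromℕ-+ c₂ (t ℕ.* c₁ ℕ.+ tail))
      (cong (λ x → fromℕ c₂ + x) (trans (fromℕ-+ (t ℕ.* c₁) tail)
        (cong (_+ fromℕ tail) (fromℕ-* t c₁))))))
  cancel : ∀ x y → x ≡ (y + x) - y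
  cancel = solve 2 (λ x y → x := (y :+ x) :- y) refl
    where open +-*-Solver
  regroup : ∀ d c₂ t c₁ f Σc p c₀ c₃ → d * (c₂ + (t * c₁ + (f * Σc + p * c₀))) - c₃ ≡
    (d * f) * Σc + (d * p) * c₀ + (d * t) * c₁ - c₃ + d * c₂
  regroup = solve 9 (λ d c₂ t c₁ f Σc p c₀ c₃ → d :* (c₂ :+ (t :* c₁ :+ (f :* Σc :+ p :* c₀)))
      :- c₃ :=
    (d :* f) :* Σc :+ (d :* p) :* c₀ :+ (d :* t) :* c₁ :- c₃ :+ d :* c₂) refl
    where open +-*-Solver

-- Avoiding 213

213′ : Word
213′ = 2 ∷ 1 ∷ 3 ∷ []

-- Avoidance of 213 in a form suited to induction on the word: the head `a` is tested in the role of
-- the 2, against all pairs of later letters.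
data Free : Word → Set where
  []  : Free []
  _∷_ : ∀ {a w} → AllPairs (λ b c → ¬ (b < a × a < c)) w → Free w → Free (a ∷ w)

213≅ : ∀ {a b c} → b < a → a < c → 213′ ≅ (a ∷ b ∷ c ∷ [])
213≅ {a} {b} {c} b<a a<c = refl , order
  where
  both : ∀ {P Q : Set} → P → Q → P ⇔ Q
  both p q = mk⇔ (λ _ → q) (λ _ → p)
  neither : ∀ {P Q : Set} → ¬ P → ¬ Q → P ⇔ Q
  neither ¬p ¬q = mk⇔ (λ p → contradiction p ¬p) (λ q → contradiction q ¬q)
  order : ∀ i j → _
  order zero             zero             = neither (<-irrefl refl) (<-irrefl refl)
  order zero             (suc zero)       = neither (<-asym (n<1+n 1)) (<-asym b<a)
  order zero             (suc (suc zero)) = both (n<1+n 2) a<c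
  order (suc zero)       zero             = both (n<1+n 1) b<a
  order (suc zero)       (suc zero)       = neither (<-irrefl refl) (<-irrefl refl)
  order (suc zero)       (suc (suc zero)) = both (m<n⇒m<1+n (n<1+n 1)) (<-trans b<a a<c)
  order (suc (suc zero)) zero             = neither (<-asym (n<1+n 2)) (<-asym a<c)
  order (suc (suc zero)) (suc zero)       =
    neither (<-asym (m<n⇒m<1+n (n<1+n 1))) (<-asym (<-trans b<a a<c))
  order (suc (suc zero)) (suc (suc zero)) = neither (<-irrefl refl) (<-irrefl refl)

≺⇔ : ∀ {w} → 213′ ≺ w ⇔ (∃[ a ] ∃[ b ] ∃[ c ] (a ∷ b ∷ c ∷ []) ⊆ w × b < a × a < c)
≺⇔ = mk⇔
  (λ { (a ∷ b ∷ c ∷ [] , τ⊆ , refl , order) → a , b , c , τ⊆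
     , to (order (suc zero) zero) (n<1+n 1) , to (order zero (suc (suc zero))) (n<1+n 2)
     ; ([] , _ , () , _) ; (_ ∷ [] , _ , () , _) ; (_ ∷ _ ∷ [] , _ , () , _)
     ; (_ ∷ _ ∷ _ ∷ _ ∷ _ , _ , () , _) })
  (λ (a , b , c , τ⊆ , b<a , a<c) → (a ∷ b ∷ c ∷ []) , τ⊆ , 213≅ b<a a<c)

AllPairs-tabulate : ∀ {A : Set} {R : A → A → Set} {xs} →
                    (∀ {x y} → (x ∷ y ∷ []) ⊆ xs → R x y) → AllPairs R xs
AllPairs-tabulate {xs = []}     f = []
AllPairs-tabulate {xs = x ∷ xs} f =
  All.tabulate (λ y∈ → f (refl ∷ from∈ y∈)) ∷ AllPairs-tabulate (f ∘ (x ∷ʳ_))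

AllPairs-lookup : ∀ {A : Set} {R : A → A → Set} {x y xs} →
                  AllPairs R xs → (x ∷ y ∷ []) ⊆ xs → R x y
AllPairs-lookup (_  ∷ ps) (_    ∷ʳ τ) = AllPairs-lookup ps τ
AllPairs-lookup (px ∷ _)  (refl ∷  τ) = All.lookup px (to∈ τ)

avoids⇔Free : ∀ {w} → w avoids 213′ ⇔ Free w
avoids⇔Free = mk⇔ (free ∘ λ av τ (b<a , a<c) → av (from ≺⇔ (_ , _ , _ , τ , b<a , a<c)))
                  λ fr σ≺w → let (_ , _ , _ , τ , b<a , a<c) = to ≺⇔ σ≺w in lookup fr τ (b<a , a<c)
  where
  free : ∀ {w} → (∀ {a b c} → (a ∷ b ∷ c ∷ []) ⊆ w → ¬ (b < a × a < c)) → Free w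
  free {[]}    f = []
  free {a ∷ w} f = AllPairs-tabulate (f ∘ (refl ∷_)) ∷ free (f ∘ (a ∷ʳ_))
  lookup : ∀ {w a b c} → Free w → (a ∷ b ∷ c ∷ []) ⊆ w → ¬ (b < a × a < c)
  lookup (_ ∷ fr) (_    ∷ʳ τ) = lookup fr τ
  lookup (ps ∷ _) (refl ∷  τ) = AllPairs-lookup ps τ

avoids-⊆ : ∀ {σ v w} → v ⊆ w → w avoids σ → v avoids σ
avoids-⊆ v⊆w av (τ , τ⊆v , σ≅τ) = av (τ , ⊆-trans τ⊆v v⊆w , σ≅τ)

Free-⊆ : ∀ {v w} → v ⊆ w → Free w → Free v
Free-⊆ v⊆w = to avoids⇔Free ∘ avoids-⊆ v⊆w ∘ from avoids⇔Free

module _ {x : ℕ} where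

  -- The minimum `x` cannot play the 2. If the 2 lies in `u`, then so does the 3, because every
  -- letter of `x ∷ v` is smaller; the whole occurrence then lies in `u`.
  Free-join : ∀ {u v} → All (x <_) u → All (x <_) v → All (λ a → All (_< a) v) u →
              Free u → Free v → Free (u ++ x ∷ v)
  Free-join {[]} _ x<v _ _ fv =
    AllPairs-tabulate (λ τ (b<x , _) → <-asym b<x (All.lookup x<v (Any-resp-⊆ τ (here refl)))) ∷ fv
  Free-join {a ∷ u} (x<a ∷ x<u) x<v (v<a ∷ v<u) (ps ∷ fu) fv =
    AllPairs.++⁺ ps
      (All.tabulate (λ c∈ (_ , a<c) → <-asym a<c (All.lookup v<a c∈))
        ∷ AllPairs-tabulate (λ τ (_ , a<c) →
            <-asym a<c (All.lookup v<a (Any-resp-⊆ τ (there (here refl))))))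
      (All.tabulate λ _ → (λ (_ , a<x) → <-asym a<x x<a)
                        ∷ All.map (λ c<a (_ , a<c) → <-asym a<c c<a) v<a)
    ∷ Free-join x<u x<v v<u fu fv

  -- If `a` in `u` were smaller than `c` in `v`, then `a`, `x`, `c` would form a 213; disjointness
  -- excludes `a ≡ c`.
  Free-split : ∀ {u v} → All (x <_) u → (∀ {a} → a ∈ u → a ∉ v) → Free (u ++ x ∷ v) →
               All (λ a → All (_< a) v) u
  Free-split {u} x<u disjoint fr = All.tabulate λ {a} a∈ → All.tabulate λ {c} c∈ →
    ≤∧≢⇒< (≮⇒≥ λ a<c → from avoids⇔Free fr (from ≺⇔
            (a , x , c , Sublist.++⁺ (from∈ a∈) (refl ∷ from∈ c∈) , All.lookup x<u a∈ , a<c)))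
          λ { refl → disjoint a∈ c∈ }

module _ (w : Word) where

  rank : ℕ → ℕ
  rank x = length (filter (_≤? x) w)

  rank-filter : ∀ {x y} → x ≤ y → filter (_≤? x) w ⊆ filter (_≤? y) w
  rank-filter {x} {y} x≤y = Sublist.filter⁺ (_≤? x) (_≤? y)
    (λ { refl z≤x → ≤-trans z≤x x≤y }) (⊆-refl {x = w})

  -- The letters up to `x` form a sublist of those up to `y`. If the lengths agreed, the two lists
  -- would coincide and `y` would be at most `x`.
  rank-strict : ∀ {x y} → y ∈ w → x < y → rank x < rank y
  rank-strict {x} {y} y∈ x<y = ≤∧≢⇒< (Sublist.length-mono-≤ sub) λ eq →
    <⇒≱ x<y (proj₂ (∈-filter⁻ (_≤? x) {xs = w}
      (subst (y ∈_) (sym (≋⇒≡ (Sublist.to-≋ eq sub))) (∈-filter⁺ (_≤? y) y∈ ≤-refl))))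
    where sub = rank-filter (<⇒≤ x<y)

  rank-reflects : ∀ {x y} → rank x < rank y → x < y
  rank-reflects {x} {y} r< = ≰⇒> λ y≤x → <⇒≱ r< (Sublist.length-mono-≤ (rank-filter y≤x))

Free-map⁺ : ∀ {f : ℕ → ℕ} {w} → (∀ {x y} → f x < f y → x < y) → Free w → Free (map f w)
Free-map⁺ reflects []        = []
Free-map⁺ reflects (ps ∷ fr) =
  AllPairs.map⁺ (AllPairs.map (λ ¬p (b<a , a<c) → ¬p (reflects b<a , reflects a<c)) ps)
  ∷ Free-map⁺ reflects fr

-- Ranks are strictly increasing on the letters of `w` and reflect the order everywhere, so
-- occurrences of 213 can be carried in both directions.
rescale-avoids : ∀ {w} → rescale w avoids 213′ ⇔ w avoids 213′
rescale-avoids {w} = mk⇔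
  (λ av σ≺w → let (a , b , c , τ , b<a , a<c) = to ≺⇔ σ≺w in
     av (from ≺⇔ (_ , _ , _ , Sublist.map⁺ (rank w) τ
       , rank-strict w (Any-resp-⊆ τ (here refl)) b<a
       , rank-strict w (Any-resp-⊆ τ (there (there (here refl)))) a<c)))
  (from avoids⇔Free ∘ Free-map⁺ (rank-reflects w) ∘ to avoids⇔Free)

-- The maximal block of entries at least k

∈-inits⁺ : ∀ (t : Word) {q} → t ∈ inits (t ++ q)
∈-inits⁺ []      = here refl
∈-inits⁺ (a ∷ t) = there (∈-map⁺ (a ∷_) (∈-inits⁺ t))

∈-inits⁻ : ∀ {t : Word} w → t ∈ inits w → ∃[ q ] w ≡ t ++ q
∈-inits⁻ w       (here refl) = w , refl
∈-inits⁻ (a ∷ w) (there t∈)  with ∈-map⁻ (a ∷_) t∈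
... | t , t∈′ , refl with ∈-inits⁻ w t∈′
... | q , refl = q , refl

∈-tails⁺ : ∀ (p : Word) {t} → t ∈ tails (p ++ t)
∈-tails⁺ []      = here refl
∈-tails⁺ (_ ∷ p) = there (∈-tails⁺ p)

∈-tails⁻ : ∀ {t : Word} w → t ∈ tails w → ∃[ p ] w ≡ p ++ t
∈-tails⁻ w       (here refl) = [] , refl
∈-tails⁻ (a ∷ w) (there t∈) with ∈-tails⁻ w t∈
... | p , refl = a ∷ p , refl

∈-substrings⁺ : ∀ p t {q} → t ∈ substrings (p ++ t ++ q)
∈-substrings⁺ p t = ∈-concatMap⁺ inits (lose (∈-tails⁺ p) (∈-inits⁺ t))

∈-substrings⁻ : ∀ {t} w → t ∈ substrings w → ∃₂ λ p q → w ≡ p ++ t ++ q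
∈-substrings⁻ w t∈ with find (∈-concatMap⁻ inits t∈)
... | t′ , t′∈ , t∈t′ with ∈-tails⁻ w t′∈ | ∈-inits⁻ t′ t∈t′
... | p , refl | q , refl = p , q , refl

module _ {y : ℕ} where

  prefix-before : ∀ t {q z w} → y ∉ t → t ++ q ≡ z ++ y ∷ w → ∃[ q′ ] z ≡ t ++ q′
  prefix-before []      {z = z}      y∉ eq   = z , refl
  prefix-before (a ∷ t) {z = []}     y∉ refl = contradiction (here refl) y∉
  prefix-before (a ∷ t) {z = b ∷ z}  y∉ eq with ∷-injective eq
  ... | refl , eq′ with prefix-before t (y∉ ∘ there) eq′
  ... | q′ , refl = q′ , refl

  -- A factor without `y` cannot straddle an occurrence of `y`. Walking along the offset `p`, either
  -- `t` starts within `z` and must stop before `y`, or `p` runs past `y` and `t` lies in `w`.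
  substring-on-one-side : ∀ p t {q} z {w} → y ∉ t → p ++ t ++ q ≡ z ++ y ∷ w →
    (∃₂ λ p′ q′ → z ≡ p′ ++ t ++ q′) ⊎ (∃₂ λ p′ q′ → w ≡ p′ ++ t ++ q′)
  substring-on-one-side []      t z       y∉ eq =
    let (q′ , eq′) = prefix-before t y∉ eq in inj₁ ([] , q′ , eq′)
  substring-on-one-side (_ ∷ p) t []      y∉ eq = inj₂ (p , _ , sym (proj₂ (∷-injective eq)))
  substring-on-one-side (_ ∷ p) t (a ∷ z) y∉ eq =
    [ (λ (p′ , q′ , eq′) → inj₁ (a ∷ p′ , q′ , cong (a ∷_) eq′)) , inj₂ ]′
      (substring-on-one-side p t z y∉ (proj₂ (∷-injective eq)))

substring-shorter : ∀ p {t q : Word} → length (p ++ t ++ q) ≤ length t → t ≡ p ++ t ++ q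
substring-shorter []      {[]}    {[]}    _         = refl
substring-shorter []      {a ∷ t} {q}     (s≤s len) = cong (a ∷_) (substring-shorter [] len)
substring-shorter (a ∷ p) {t}     {q}     len       = contradiction len (<⇒≱ (s≤s (begin
  length t                            ≤⟨ m≤m+n (length t) (length q) ⟩
  length t ℕ.+ length q               ≡⟨ length-++ t ⟨
  length (t ++ q)                     ≤⟨ m≤n+m (length (t ++ q)) (length p) ⟩
  length p ℕ.+ length (t ++ q)        ≡⟨ length-++ p ⟨
  length (p ++ t ++ q)                ∎)))
  where open ≤-Reasoning

∈-substring : ∀ {k : ℕ} p {t q} → k ∈ t → k ∈ p ++ t ++ q
∈-substring p k∈ = ∈-++⁺ʳ p (∈-++⁺ˡ k∈)

-- The word picked by `argmax` is at least as long as the candidate `w` and, by `maximal`, is a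
-- factor of `w`, hence equals it. Ties in `argmax` therefore do no harm.
s≡ : ∀ π {k w} → w ∈ substrings π → k ∈ w → All (k ≤_) w →
     (∀ {t} → t ∈ substrings π → k ∈ t → All (k ≤_) t → ∃₂ λ p q → w ≡ p ++ t ++ q) →
     s π k ≡ w
s≡ π {k} {w} w∈ k∈w k≤w maximal = conclude (argmax-sel length [] candidates)
  where
  block? = λ t → ∈-dec _≟_ k t ×-dec all? (k ≤?_) t
  candidates = filter block? (substrings π)
  longest : length w ≤ length (s π k)
  longest = All.lookup (f[xs]≤f[argmax] {f = length} [] candidates)
    (∈-filter⁺ block? w∈ (k∈w , k≤w))
  conclude : s π k ≡ [] ⊎ s π k ∈ candidates → s π k ≡ w
  -- The default value `[]` is too short: `w` contains `k` and so has positive length.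
  conclude (inj₁ eq) = contradiction
    (subst (λ t → length w ≤ length t) eq longest) (<⇒≱ (∈-length k∈w))
  conclude (inj₂ s∈) with ∈-filter⁻ block? {xs = substrings π} s∈
  ... | s∈π , k∈s , k≤s with maximal s∈π k∈s k≤s
  ... | p , q , eq =
    trans (substring-shorter p (subst (λ v → length v ≤ length (s π k)) eq longest)) (sym eq)

module _ {k y : ℕ} {w z : Word} (y<k : y < k) (k∈w : k ∈ w) (k≤w : All (k ≤_) w) (k∉z : k ∉ z) where

  private
    one-side : ∀ {t} u {v} → t ∈ substrings (u ++ y ∷ v) → All (k ≤_) t →
      (∃₂ λ p q → u ≡ p ++ t ++ q) ⊎ (∃₂ λ p q → v ≡ p ++ t ++ q)
    one-side {t} u {v} t∈ k≤t =
      let (p , q , eq) = ∈-substrings⁻ (u ++ y ∷ v) t∈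
      in substring-on-one-side p t u (λ y∈ → <⇒≱ y<k (All.lookup k≤t y∈)) (sym eq)

    not-in-z : ∀ {t} → k ∈ t → ¬ (∃₂ λ p q → z ≡ p ++ t ++ q)
    not-in-z k∈t (p , q , refl) = k∉z (∈-substring p k∈t)

  -- A block with all entries at least `k` misses `y`, so it stays on one side of it; containing
  -- `k`, it cannot lie in `z`.
  s-right : s (z ++ y ∷ w) k ≡ w
  s-right = s≡ (z ++ y ∷ w)
    (subst (λ π → w ∈ substrings π)
      (trans (++-assoc z (y ∷ []) (w ++ [])) (cong (λ v → z ++ y ∷ v) (++-identityʳ w)))
      (∈-substrings⁺ (z ++ (y ∷ [])) w))
    k∈w k≤w λ t∈ k∈t k≤t →
      [ (λ t⊆z → contradiction t⊆z (not-in-z k∈t)) , id ]′ (one-side z t∈ k≤t)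

  s-left : s (w ++ y ∷ z) k ≡ w
  s-left = s≡ (w ++ y ∷ z) (∈-substrings⁺ [] w) k∈w k≤w λ t∈ k∈t k≤t →
    [ id , (λ t⊆z → contradiction t⊆z (not-in-z k∈t)) ]′ (one-side w t∈ k≤t)

-- Avoiders of 213 as binary trees

Sorted : Word → Set
Sorted = AllPairs _<_

Sorted⇒Unique : ∀ {xs} → Sorted xs → Unique xs
Sorted⇒Unique = AllPairs.map <⇒≢

Unique-resp-↭ : ∀ {xs ys : Word} → xs ↭ ys → Unique xs → Unique ys
Unique-resp-↭ = SetoidPermutation.Unique-resp-↭ (setoid ℕ) ∘ ↭⇒↭ₛ

AllPairs-++⁻ : ∀ {A : Set} {R : A → A → Set} xs {ys} →
               AllPairs R (xs ++ ys) → All (λ x → All (R x) ys) xs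
AllPairs-++⁻ []       ps       = []
AllPairs-++⁻ (x ∷ xs) (p ∷ ps) = All.++⁻ʳ xs p ∷ AllPairs-++⁻ xs ps

Unique-++⇒disjoint : ∀ {xs ys : Word} → Unique (xs ++ ys) → ∀ {a} → a ∈ xs → a ∉ ys
Unique-++⇒disjoint {xs} xs! a∈xs a∈ys =
  All.lookup (All.lookup (AllPairs-++⁻ xs xs!) a∈xs) a∈ys refl

++-∷-injective : ∀ {x : ℕ} u {u′ v v′} → x ∉ u → x ∉ u′ → u ++ x ∷ v ≡ u′ ++ x ∷ v′ →
                 u ≡ u′ × v ≡ v′
++-∷-injective []      {[]}     _  _   refl = refl , refl
++-∷-injective []      {a ∷ u′} _  x∉′ refl = contradiction (here refl) x∉′
++-∷-injective (a ∷ u) {[]}     x∉ _   refl = contradiction (here refl) x∉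
++-∷-injective (a ∷ u) {b ∷ u′} x∉ x∉′ eq with ∷-injective eq
... | refl , eq′ with ++-∷-injective u (x∉ ∘ there) (x∉′ ∘ there) eq′
... | refl , refl = refl , refl

-- The avoider with shape `t` on the increasing alphabet `xs`. The root is the minimum `x`; the part
-- after it takes the smallest remaining letters and the part before it the largest. The value at a
-- node with empty alphabet is junk, excluded by `size t ≡ length xs`.
word : Tree → Word → Word
word leaf       _        = []
word (node l r) []       = []
word (node l r) (x ∷ xs) = word l (drop (size r) xs) ++ x ∷ word r (take (size r) xs)

module _ {m n : ℕ} {xs : Word} (eq : m ℕ.+ n ≡ length xs) where

  length-drop≡ : m ≡ length (drop n xs)
  length-drop≡ = sym (trans (length-drop n xs) (trans (cong (ℕ._∸ n) (sym eq)) (m+n∸n≡m m n)))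

  length-take≡ : n ≡ length (take n xs)
  length-take≡ = sym (trans (length-take n xs) (m≤n⇒m⊓n≡m (≤-trans (m≤n+m n m) (≤-reflexive eq))))

word-↭ : ∀ t xs → size t ≡ length xs → word t xs ↭ xs
word-↭ leaf       []       eq = ↭-refl
word-↭ (node l r) (x ∷ xs) eq =
  ↭-trans (shift x (word l (drop k xs)) (word r (take k xs))) (↭-prep x (↭-trans
  (++⁺ (word-↭ l _ (length-drop≡ (suc-injective eq)))
       (word-↭ r _ (length-take≡ (suc-injective eq))))
  (↭-trans (++-comm (drop k xs) (take k xs)) (↭-reflexive (take++drop≡id k xs)))))
  where k = size r

take<drop : ∀ k {xs} → Sorted xs → All (λ a → All (_< a) (take k xs)) (drop k xs)
take<drop k {xs} sorted = All.tabulate λ a∈ → All.tabulate λ c∈ →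
  All.lookup (All.lookup (AllPairs-++⁻ (take k xs)
    (subst Sorted (sym (take++drop≡id k xs)) sorted)) c∈) a∈

word-Free : ∀ t {xs} → Sorted xs → size t ≡ length xs → Free (word t xs)
word-Free leaf                         _            eq = []
word-Free (node l r) {x ∷ xs} (x<xs ∷ sorted) eq = Free-join
  (All-resp-↭ (↭-sym l↭) (All.drop⁺ (size r) x<xs))
  (All-resp-↭ (↭-sym r↭) (All.take⁺ (size r) x<xs))
  (All-resp-↭ (↭-sym l↭) (All.map (All-resp-↭ (↭-sym r↭)) (take<drop (size r) sorted)))
  (word-Free l (AllPairs.drop⁺ (size r) sorted) l≡)
  (word-Free r (AllPairs.take⁺ (size r) sorted) r≡)
  where
  l≡ = length-drop≡ (suc-injective eq)
  r≡ = length-take≡ (suc-injective eq)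
  l↭ = word-↭ l (drop (size r) xs) l≡
  r↭ = word-↭ r (take (size r) xs) r≡

-- The minimum `x` occurs once, so its position determines the two parts of the word, and induction
-- recovers the subtrees.
word-injective : ∀ t t′ {xs} → Unique xs → size t ≡ length xs → size t′ ≡ length xs →
                 word t xs ≡ word t′ xs → t ≡ t′
word-injective leaf       leaf         {[]}     _           _  _   _ = refl
word-injective (node l r) (node l′ r′) {x ∷ xs} (x∉ ∷ xs!) eq eq′ w≡ =
  let (l≡ , r≡) = ++-∷-injective (word l (drop (size r) xs)) (fresh l r eq) (fresh l′ r′ eq′) w≡
      -- The alphabets of both subtrees depend on the size of the right one, so this size is
      -- compared first, as the length of the part after `x`.
      sr : size r ≡ size r′
      sr = trans (len l r eq) (trans (cong length r≡) (sym (len l′ r′ eq′)))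
  in cong₂ node
    (word-injective l l′ (Unique.drop⁺ (size r) xs!) (length-drop≡ (suc-injective eq))
      (subst (λ k → size l′ ≡ length (drop k xs)) (sym sr) (length-drop≡ (suc-injective eq′)))
      (trans l≡ (cong (word l′ ∘ (λ k → drop k xs)) (sym sr))))
    (word-injective r r′ (Unique.take⁺ (size r) xs!) (length-take≡ (suc-injective eq))
      (subst (λ k → size r′ ≡ length (take k xs)) (sym sr) (length-take≡ (suc-injective eq′)))
      (trans r≡ (cong (word r′ ∘ (λ k → take k xs)) (sym sr))))
  where
  fresh : ∀ l r → suc (size l ℕ.+ size r) ≡ suc (length xs) → x ∉ word l (drop (size r) xs)
  fresh l r eq x∈ = All.lookup (All.drop⁺ (size r) x∉)
    (∈-resp-↭ (word-↭ l _ (length-drop≡ (suc-injective eq))) x∈) refl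
  len : ∀ l r → suc (size l ℕ.+ size r) ≡ suc (length xs) →
        size r ≡ length (word r (take (size r) xs))
  len l r eq = let r≡ = length-take≡ (suc-injective eq) in
    trans r≡ (sym (↭-length (word-↭ r _ r≡)))

-- Induction on `xs`, by the place of its minimum `x`. If `x` is in `u`, then `v` is empty, as its
-- letters would be below the minimum; if `x` is in `v`, it is removed from there and from `xs`.
split-sorted : ∀ {xs} v u → Sorted xs → v ++ u ↭ xs → All (λ a → All (_< a) v) u →
               v ↭ take (length v) xs × u ↭ drop (length v) xs
split-sorted {[]}     []      u _ ↭xs _ = ↭-refl , ↭xs
split-sorted {[]}     (_ ∷ _) u _ ↭xs _ = contradiction ↭xs ¬x∷xs↭[]
split-sorted {x ∷ xs} v u (x<xs ∷ sorted) ↭xs v<u with ∈-++⁻ v (∈-resp-↭ (↭-sym ↭xs) (here refl))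
... | inj₂ x∈u = v-empty v ↭xs (All.lookup v<u x∈u)
  where
  x≤ : ∀ {b} → b ∈ x ∷ xs → x ≤ b
  x≤ (here refl) = ≤-refl
  x≤ (there b∈)  = <⇒≤ (All.lookup x<xs b∈)
  v-empty : ∀ v → v ++ u ↭ x ∷ xs → All (_< x) v →
            v ↭ take (length v) (x ∷ xs) × u ↭ drop (length v) (x ∷ xs)
  v-empty []      ↭xs _         = ↭-refl , ↭xs
  v-empty (b ∷ v) ↭xs (b<x ∷ _) = contradiction b<x (≤⇒≯ (x≤ (∈-resp-↭ ↭xs (here refl))))
... | inj₁ x∈v with ∈-∃++ x∈v
-- Exposes the length of `v₁ ++ x ∷ v₂` as a successor, so that `take` and `drop` reduce on
-- `x ∷ xs`.
... | v₁ , v₂ , refl rewrite ↭-length (shift x v₁ v₂) =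
  let x-first = shift x v₁ v₂
      (v↭ , u↭) = split-sorted (v₁ ++ v₂) u sorted
        (drop-∷ (↭-trans (++⁺ (↭-sym x-first) ↭-refl) ↭xs))
        (All.map (λ v<a → All.tail (All-resp-↭ x-first v<a)) v<u)
  in ↭-trans x-first (↭-prep x v↭) , u↭

Arrangement : Word → Pred Word 0ℓ
Arrangement xs w = w ↭ xs × Free w

-- Cut at the minimum: `Free-split` orders the two sides and `split-sorted` identifies their
-- alphabets. The bound `n` drives the recursion, as `take` and `drop` do not yield structurally
-- smaller lists.
word-surjective : ∀ n {xs w} → length xs ≤ n → Sorted xs → Arrangement xs w →
                  ∃[ t ] size t ≡ length xs × w ≡ word t xs
word-surjective n       {[]}     _   _ (↭xs , _) = leaf , refl , ↭-empty-inv ↭xs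
word-surjective (suc n) {x ∷ xs} (s≤s len) (x<xs ∷ sorted) (↭xs , fr)
  with ∈-∃++ (∈-resp-↭ (↭-sym ↭xs) (here refl))
... | u , v , refl =
  node l r
  , cong suc (trans (cong₂ ℕ._+_ (trans l≡ (sym (↭-length u↭))) size-r)
      (trans (sym (length-++ u)) (↭-length uv↭)))
  , cong₂ (λ u v → u ++ x ∷ v)
      (trans wl (cong (λ k → word l (drop k xs)) (sym size-r)))
      (trans wr (cong (λ k → word r (take k xs)) (sym size-r)))
  where
  uv↭ : u ++ v ↭ xs
  uv↭ = drop-mid u [] ↭xs
  x<uv : All (x <_) (u ++ v)
  x<uv = All-resp-↭ (↭-sym uv↭) x<xs
  split = split-sorted v u sorted (↭-trans (++-comm v u) uv↭)
    (Free-split (All.++⁻ˡ u x<uv)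
      (Unique-++⇒disjoint (Unique-resp-↭ (↭-sym uv↭) (Sorted⇒Unique sorted))) fr)
  v↭ = proj₁ split
  u↭ = proj₂ split
  u≤n : length (drop (length v) xs) ≤ n
  u≤n = ≤-trans (≤-reflexive (length-drop (length v) xs))
    (≤-trans (m∸n≤m (length xs) (length v)) len)
  v≤n : length (take (length v) xs) ≤ n
  v≤n = ≤-trans (≤-reflexive (length-take (length v) xs))
    (≤-trans (m⊓n≤n (length v) (length xs)) len)
  L = word-surjective n {drop (length v) xs} u≤n (AllPairs.drop⁺ (length v) sorted)
    (u↭ , Free-⊆ (Sublist.++⁺ʳ (x ∷ v) ⊆-refl) fr)
  R = word-surjective n {take (length v) xs} v≤n (AllPairs.take⁺ (length v) sorted)
    (v↭ , Free-⊆ (Sublist.++⁺ˡ u (x ∷ʳ ⊆-refl)) fr)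
  l = proj₁ L
  r = proj₁ R
  l≡ = proj₁ (proj₂ L)
  wl = proj₂ (proj₂ L)
  wr = proj₂ (proj₂ R)
  size-r : size r ≡ length v
  size-r = trans (proj₁ (proj₂ R)) (sym (↭-length v↭))

card-Arrangement : ∀ {xs} → Sorted xs → HasCardinality (Arrangement xs) (forestCount 1 (length xs))
card-Arrangement {xs} sorted = card-bijection (λ t → word t xs)
  (λ {t} {t′} → word-injective t t′ (Sorted⇒Unique sorted))
  (λ {t} eq → word-↭ t xs eq , word-Free t sorted eq)
  (word-surjective (length xs) ≤-refl sorted)
  (card-trees (length xs))

-- Counting pairs whose second word avoids 213

FreePair : ℕ → Word → Pred (Word × Word) 0ℓ
FreePair x xs (z , w) = z ++ w ↭ x ∷ xs × x ∈ w × Free w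

module _ {x : ℕ} {xs : Word} (sorted : Sorted (x ∷ xs)) where

  -- If `z` is empty, then `w` is any avoider on the full alphabet. Otherwise `z` starts with a
  -- letter `a` of `xs`, each choice leaving `k` pairs.
  card-FreePair-step : ∀ {k} →
    (∀ {a} → a ∈ xs → HasCardinality (λ (z , w) → FreePair x xs (a ∷ z , w)) k) →
    HasCardinality (FreePair x xs) (forestCount 1 (suc (length xs)) ℕ.+ length xs ℕ.* k)
  card-FreePair-step fibre = card-resp (λ (z , w) → mk⇔ into (split z w))
    (card-∪ (λ { {_ , _} (_ , _ , refl) (_ , _ , ()) })
      (card-image ([] ,_) (λ { _ _ refl → refl }) (card-Arrangement sorted))
      (card-image (λ (a , (z , w)) → a ∷ z , w) (λ { _ _ refl → refl })
        (card-Fibred (Sorted⇒Unique (AllPairs.tail sorted)) fibre)))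
    where
    Empty Cons : Pred (Word × Word) 0ℓ
    Empty p = ∃[ w ] Arrangement (x ∷ xs) w × p ≡ ([] , w)
    Cons p = ∃[ q ] Fibred xs (λ a (z , w) → FreePair x xs (a ∷ z , w)) q ×
             p ≡ (proj₁ q ∷ proj₁ (proj₂ q) , proj₂ (proj₂ q))
    into : ∀ {p} → Empty p ⊎ Cons p → FreePair x xs p
    into (inj₁ (w , (↭xs , fr) , refl))  = ↭xs , ∈-resp-↭ (↭-sym ↭xs) (here refl) , fr
    into (inj₂ (_ , (_ , fp) , refl))    = fp
    split : ∀ z w → FreePair x xs (z , w) → Empty (z , w) ⊎ Cons (z , w)
    split []      w (↭xs , _ , fr) = inj₁ (w , (↭xs , fr) , refl)
    split (a ∷ z) w fp@(↭xs , x∈w , _) = inj₂ ((a , z , w) , (a∈xs , fp) , refl)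
      where
      a∈xs : a ∈ xs
      a∈xs with ∈-resp-↭ ↭xs (here refl)
      ... | there a∈  = a∈
      -- The first letter of `z` is not `x`, which already occurs in `w`.
      ... | here refl = contradiction x∈w
        (Unique-++⇒disjoint {a ∷ z} (Unique-resp-↭ (↭-sym ↭xs) (Sorted⇒Unique sorted)) (here refl))

Sorted-remove : ∀ us {a vs} → Sorted (us ++ a ∷ vs) → Sorted (us ++ vs)
Sorted-remove []       (_ ∷ sorted) = sorted
Sorted-remove (u ∷ us) (u< ∷ sorted) with All.++⁻ us u<
... | <us , _ ∷ <vs = All.++⁺ <us <vs ∷ Sorted-remove us sorted

card-FreePair : ∀ t {x xs} → length xs ≡ t → Sorted (x ∷ xs) →
                HasCardinality (FreePair x xs) (pairCount t)
-- There is no letter to peel off, so the fibre condition is vacuous and `k = 0` is an arbitrary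
-- choice.
card-FreePair zero {xs = []} refl sorted = subst (HasCardinality _) (+-identityʳ (forestCount 1 1))
  (card-FreePair-step sorted {k = 0} λ ())
card-FreePair (suc t) {x} {xs} len sorted =
  subst (λ m → HasCardinality (FreePair x xs) (forestCount 1 (suc m) ℕ.+ m ℕ.* pairCount t)) len
    (card-FreePair-step sorted fibre)
  where
  fibre : ∀ {a} → a ∈ xs → HasCardinality (λ (z , w) → FreePair x xs (a ∷ z , w)) (pairCount t)
  fibre {a} a∈ with ∈-∃++ a∈
  -- Deleting `a` leaves the same problem on the sorted alphabet `us ++ vs`, with the same minimum
  -- `x` and one letter fewer.
  ... | us , vs , refl = card-resp
    (λ (z , w) → mk⇔
      (λ (↭rest , x∈w , fr) → ↭-trans (↭-prep a ↭rest) (↭-sym (shift a (x ∷ us) vs)) , x∈w , fr)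
      (λ (↭xs , x∈w , fr) → drop-mid [] (x ∷ us) ↭xs , x∈w , fr))
    (card-FreePair t (suc-injective (trans (sym (↭-length (shift a us vs))) len))
      (Sorted-remove (x ∷ us) sorted))

-- Permutations cut at the entry 1

module _ (t : ℕ) where

  private
    n : ℕ
    n = 2 ℕ.+ t

    -- Chosen so that `1 ∷ 2 ∷ rest` is `applyUpTo suc n` by computation.
    rest : Word
    rest = applyUpTo (λ i → 3 ℕ.+ i) t

    sorted : Sorted (1 ∷ 2 ∷ rest)
    sorted = AllPairs.applyUpTo⁺₁ suc n λ i<j _ → s≤s i<j

  module Pair (z w : Word) (↭2∷rest : z ++ w ↭ 2 ∷ rest) (2∈w : 2 ∈ w) where

    2≤ : All (2 ≤_) (z ++ w)
    2≤ = All-resp-↭ (↭-sym ↭2∷rest) (AllPairs.head sorted)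

    1∉z : 1 ∉ z
    1∉z 1∈ = <-irrefl refl (All.lookup (All.++⁻ˡ z 2≤) 1∈)

    1∉w : 1 ∉ w
    1∉w 1∈ = <-irrefl refl (All.lookup (All.++⁻ʳ z 2≤) 1∈)

    2∉z : 2 ∉ z
    2∉z 2∈z = Unique-++⇒disjoint
      (Unique-resp-↭ (↭-sym ↭2∷rest) (Sorted⇒Unique (AllPairs.tail sorted)))
      2∈z 2∈w

    s-right′ : s (z ++ 1 ∷ w) 2 ≡ w
    s-right′ = s-right ≤-refl 2∈w (All.++⁻ʳ z 2≤) 2∉z

    s-left′ : s (w ++ 1 ∷ z) 2 ≡ w
    s-left′ = s-left ≤-refl 2∈w (All.++⁻ʳ z 2≤) 2∉z

    S-right : S n (z ++ 1 ∷ w)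
    S-right = ↭-trans (shift 1 z w) (↭-prep 1 ↭2∷rest)

    S-left : S n (w ++ 1 ∷ z)
    S-left = ↭-trans (shift 1 w z) (↭-prep 1 (↭-trans (++-comm w z) ↭2∷rest))

  Right Left : Word → Pred (Word × Word) 0ℓ
  Right π (z , w) = z ++ w ↭ 2 ∷ rest × 2 ∈ w × π ≡ z ++ 1 ∷ w
  Left π (z , w) = z ++ w ↭ 2 ∷ rest × 2 ∈ w × π ≡ w ++ 1 ∷ z

  -- The entry 1 leaves a factor on each side; the one that contains 2 is called `w`, and its side
  -- decides the case.
  around-1 : ∀ {π} → S n π → (∃[ p ] Right π p) ⊎ (∃[ p ] Left π p)
  around-1 {π} π∈S with ∈-∃++ (∈-resp-↭ (↭-sym π∈S) (here refl))
  ... | u , v , refl with ↭rest ← drop-mid u [] π∈S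
    with ∈-++⁻ u (∈-resp-↭ (↭-sym ↭rest) (here refl))
  ... | inj₁ 2∈u = inj₂ ((v , u) , ↭-trans (++-comm v u) ↭rest , 2∈u , refl)
  ... | inj₂ 2∈v = inj₁ ((u , v) , ↭rest , 2∈v , refl)

  s-⊆ : ∀ {π} → S n π → s π 2 ⊆ π
  s-⊆ π∈S with around-1 π∈S
  ... | inj₁ ((z , w) , ↭rest , 2∈w , refl)
    rewrite Pair.s-right′ z w ↭rest 2∈w = Sublist.++⁺ˡ z (1 ∷ʳ ⊆-refl)
  ... | inj₂ ((z , w) , ↭rest , 2∈w , refl)
    rewrite Pair.s-left′ z w ↭rest 2∈w = Sublist.++⁺ʳ (1 ∷ z) ⊆-refl

  BlockAvoids : Pred Word 0ℓ
  BlockAvoids π = S n π × g π 2 avoids 213′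

  card-BlockAvoids : HasCardinality BlockAvoids (pairCount t ℕ.+ pairCount t)
  card-BlockAvoids = card-resp (λ π → mk⇔ into (λ (π∈S , av) → split π∈S av))
    (card-∪ disjoint
      (card-image right right-injective pairs-card)
      (card-image left left-injective pairs-card))
    where
    right left : Word × Word → Word
    right (z , w) = z ++ 1 ∷ w
    left (z , w) = w ++ 1 ∷ z
    Image : (Word × Word → Word) → Pred Word 0ℓ
    Image f π = ∃[ p ] FreePair 2 rest p × π ≡ f p
    pairs-card = card-FreePair t (length-applyUpTo (λ i → 3 ℕ.+ i) t) (AllPairs.tail sorted)

    right-injective : ∀ {p q} → FreePair 2 rest p → FreePair 2 rest q → right p ≡ right q → p ≡ q
    right-injective {z , w} {z′ , w′} (↭r , 2∈ , _) (↭r′ , 2∈′ , _) eq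
      with ++-∷-injective z (Pair.1∉z z w ↭r 2∈) (Pair.1∉z z′ w′ ↭r′ 2∈′) eq
    ... | refl , refl = refl

    left-injective : ∀ {p q} → FreePair 2 rest p → FreePair 2 rest q → left p ≡ left q → p ≡ q
    left-injective {z , w} {z′ , w′} (↭r , 2∈ , _) (↭r′ , 2∈′ , _) eq
      with ++-∷-injective w (Pair.1∉w z w ↭r 2∈) (Pair.1∉w z′ w′ ↭r′ 2∈′) eq
    ... | refl , refl = refl

    disjoint : ∀ {π} → Image right π → ¬ Image left π
    disjoint ((z , w) , (↭r , 2∈ , _) , refl) ((z′ , w′) , (↭r′ , 2∈′ , _) , eq)
      -- The cut at 1 is unique, so `z` coincides with `w′` and would contain 2, which already lies
      -- in `w`.
      with ++-∷-injective z (Pair.1∉z z w ↭r 2∈) (Pair.1∉w z′ w′ ↭r′ 2∈′) eq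
    ... | refl , refl = Pair.2∉z z w ↭r 2∈ 2∈′

    into : ∀ {π} → Image right π ⊎ Image left π → BlockAvoids π
    into (inj₁ ((z , w) , (↭r , 2∈ , fr) , refl)) = S-right ,
      from rescale-avoids (subst (_avoids 213′) (sym s-right′) (from avoids⇔Free fr))
      where open Pair z w ↭r 2∈
    into (inj₂ ((z , w) , (↭r , 2∈ , fr) , refl)) = S-left ,
      from rescale-avoids (subst (_avoids 213′) (sym s-left′) (from avoids⇔Free fr))
      where open Pair z w ↭r 2∈

    split : ∀ {π} → S n π → g π 2 avoids 213′ → Image right π ⊎ Image left π
    split {π} π∈S av with to avoids⇔Free (to (rescale-avoids {s π 2}) av) | around-1 π∈S
    ... | fr | inj₁ ((z , w) , ↭r , 2∈ , refl) =
      inj₁ ((z , w) , (↭r , 2∈ , subst Free (Pair.s-right′ z w ↭r 2∈) fr) , refl)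
    ... | fr | inj₂ ((z , w) , ↭r , 2∈ , refl) =
      inj₂ ((z , w) , (↭r , 2∈ , subst Free (Pair.s-left′ z w ↭r 2∈) fr) , refl)

  private
    avoids⇒block : ∀ {π} → S n π → π avoids 213′ → g π 2 avoids 213′
    avoids⇒block π∈S = from rescale-avoids ∘ avoids-⊆ (s-⊆ π∈S)

  -- A permutation avoiding 213 always has an avoiding block, so membership in `Av` can fail only
  -- through the converse: the block avoids 213 and the permutation does not.
  ∖Av : ∀ π → (BlockAvoids ∖ Arrangement (applyUpTo suc n)) π ⇔ (S n ∖ Av 213′ 2) π
  ∖Av π = mk⇔
    (λ ((π∈S , block) , ¬arr) → π∈S , λ (_ , iff) → ¬arr (π∈S , to avoids⇔Free (from iff block)))
    (λ (π∈S , ¬av) →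
      -- If the block contained 213, the converse implication would hold vacuously and `π` would
      -- belong to `Av`.
      (π∈S , λ contains → ¬av ((n , π∈S) , mk⇔ (avoids⇒block π∈S) (contradiction contains)))
      , λ (_ , fr) → ¬av ((n , π∈S) , mk⇔ (avoids⇒block π∈S) (λ _ → from avoids⇔Free fr)))

  card-∖Av : ∃[ N ] HasCardinality (S n ∖ Av 213′ 2) N ×
             forestCount 1 n ℕ.+ N ≡ pairCount t ℕ.+ pairCount t
  card-∖Av =
    let (N , hc , eq) = card-∖ (≡-dec _≟_)
          (λ (π∈S , fr) → π∈S , avoids⇒block π∈S (from avoids⇔Free fr))
          card-BlockAvoids (card-Arrangement sorted)
    in N , card-resp ∖Av hc
       , trans (cong (λ m → forestCount 1 m ℕ.+ N) (sym (length-applyUpTo suc n))) eq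

proposition6 : ∀ (n : ℕ) → 3 ≤ n →
    ∃[ N ] (HasCardinality (S n ∖ Av (2 ∷ 1 ∷ 3 ∷ []) 2) N ×
    fromℕ N ≡
    fromℕ (2 ℕ.* (n ∸ 2) !) * (∑[1≤ i ≤ n ∸ 4 ] (catalan i /! (i ∸ 1)))
    + fromℕ (2 ℕ.* (n ∸ 2) ℕ.* (n ∸ 3)) * catalan (n ∸ 3)
    + fromℕ (2 ℕ.* (n ∸ 2)) * catalan (n ∸ 2)
    - catalan n
    + fromℕ 2 * catalan (n ∸ 1))
proposition6 (suc (suc (suc u))) (s≤s (s≤s (s≤s _))) =
  -- From `n = 2 + t = 3 + u` comes `t = suc u`.
  let (N , hc , eq) = card-∖Av (suc u) in N , hc , formula u N eq
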